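{- For each integer $n\ge 0$ let $$R_n(q)=1-(1-q)^n\sum_{m=0}^{n-1}\binom{n+m-1}{m}q^m+q^n\sum_{m=0}^{n-1}\binom{n+m-1}{m}(1-q)^m .$$ Then the polynomials $R_n(q)$ satisfy the initial conditions $R_0(q)=1$, $R_1(q)=2q$, and for every integer $n\ge 2$ $$R_n(q)=-\frac{4nq^2-4qn-6q^2-n+6q+1}{n-1}\,R_{n-1}(q)+\frac{2q(q-1)(2n-3)}{n-1}\,R_{n-2}(q).$$
   Context: Empty sums are $0$, so $R_0(q)=1$. Background on the meaning of $R_n(q)$ (the "Rosenfeld polynomial"): teams G and B play, each goal being independently scored by B with probability $q$ ($0<q<1/2$) and by G with probability $1-q$. Phase I lasts until G has scored $n$ goals. If B has then scored at least $n$ goals, B wins immediately; otherwise they continue (Phase II) and B wins if and only if the score is eventually tied. $R_n(q)$ is the probability that B wins. -}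

module Defs where

open import Algebra.Bundles.Raw using (RawRing)
open import Data.Fin using (toℕ)
open import Data.Integer using (+_)
open import Data.List using (List; []; _∷_; map)
open import Data.Nat as ℕ using (ℕ; zero; suc; NonZero; _∸_; _≤_; s≤s; z≤n)
open import Data.Nat.Combinatorics using (_C_)
open import Data.Rational as ℚ using (ℚ; 0ℚ; 1ℚ)
open import Level using (0ℓ)
open import Relation.Binary.PropositionalEquality using (_≡_)

-- Polynomials in one indeterminate q: the list a₀ ∷ a₁ ∷ … ∷ aₙ ∷ [] stands
-- for a₀ + a₁ q + … + aₙ qⁿ.  Trailing zeros are allowed, so equality is _≈_
-- below (equality of all coefficients) rather than _≡_ on lists.
ℚ[q] : Set
ℚ[q] = List ℚ

coeff : ℚ[q] → ℕ → ℚ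
coeff []      _       = 0ℚ
coeff (a ∷ p) zero    = a
coeff (a ∷ p) (suc k) = coeff p k

infix 4 _≈_

_≈_ : ℚ[q] → ℚ[q] → Set
p ≈ r = ∀ k → coeff p k ≡ coeff r k

private
  add : ℚ[q] → ℚ[q] → ℚ[q]
  add []      r       = r
  add (a ∷ p) []      = a ∷ p
  add (a ∷ p) (b ∷ r) = (a ℚ.+ b) ∷ add p r

  mul : ℚ[q] → ℚ[q] → ℚ[q]
  mul []      r = []
  mul (a ∷ p) r = add (map (a ℚ.*_) r) (0ℚ ∷ mul p r)

ℚ[q]-rawRing : RawRing 0ℓ 0ℓ
ℚ[q]-rawRing = record
  { Carrier = ℚ[q]
  ; _≈_     = _≈_
  ; _+_     = add
  ; _*_     = mul
  ; -_      = map (ℚ.-_)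
  ; 0#      = []
  ; 1#      = 1ℚ ∷ []
  }

open RawRing ℚ[q]-rawRing public using (_+_; _*_; -_; 0#; 1#)
open import Algebra.Definitions.RawSemiring (RawRing.rawSemiring ℚ[q]-rawRing) public using (_^_)
open import Algebra.Definitions.RawMonoid (RawRing.+-rawMonoid ℚ[q]-rawRing) using (sum)

infixl 6 _-_
infixl 7 _/_

_-_ : ℚ[q] → ℚ[q] → ℚ[q]
p - r = p + (- r)

q : ℚ[q]
q = 0ℚ ∷ 1ℚ ∷ []

fromℕ : ℕ → ℚ[q]
fromℕ n = (+ n ℚ./ 1) ∷ []

_/_ : ℚ[q] → (d : ℕ) .{{_ : NonZero d}} → ℚ[q]
p / d = map ((+ 1 ℚ./ d) ℚ.*_) p

n∸1-nonZero : ∀ {n} → 2 ≤ n → NonZero (n ∸ 1)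
n∸1-nonZero (s≤s (s≤s z≤n)) = _

-- Σ[ m < n ] f m = f 0 + f 1 + … + f (n - 1); it is 0# when n = 0.
Σ< : ℕ → (ℕ → ℚ[q]) → ℚ[q]
Σ< n f = sum {n} (λ i → f (toℕ i))

syntax Σ< n (λ m → t) = Σ[ m < n ] t

-- For n = 0 both sums are empty, so the truncation in n + m ∸ 1 is harmless.
R : ℕ → ℚ[q]
R n = 1#
    - (1# - q) ^ n * (Σ[ m < n ] (fromℕ ((n ℕ.+ m ∸ 1) C m) * q ^ m))
    + q ^ n * (Σ[ m < n ] (fromℕ ((n ℕ.+ m ∸ 1) C m) * (1# - q) ^ m))

{-# OPTIONS --safe #-}

-- Put x = q and y = 1 - q.  Truncations of the series of (1 - x)^(-n) satisfy a Pascal rule;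
-- multiplied by y^n it relates the two races (who is the first to score n goals?) for n + 1
-- and for n.  The contributions of C(2n-1, n) cancel in the difference and
--   R (n+1) - R n = C(2n, n) (x y)^n (x - y).
-- Since (k+1) C(2k+2, k+1) = 2 (2k+1) C(2k, k), consecutive differences are proportional,
-- (k+1) (R (k+2) - R (k+1)) = 2 (2k+1) x y (R (k+1) - R k), which is the recurrence.

module Submission where

open import Algebra.Bundles using (CommutativeRing; Semiring)
open import Algebra.Solver.Ring.AlmostCommutativeRing
  using (_-Raw-AlmostCommutative⟶_; fromCommutativeRing)
open import Data.Fin using (toℕ)
open import Data.Integer as ℤ using (+_)
import Data.Integer.Properties as ℤ
open import Data.List using ([]; _∷_; map)
import Data.Maybe as Maybe
open import Data.Nat as ℕ using (ℕ; zero; suc; _∸_; _≥_; s≤s; z≤n; _!)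
import Data.Nat.Properties as ℕ
open import Data.Nat.Combinatorics
  using (_C_; nCk≡n!/k![n-k]!; [n∸k]!k!∣n!; nCk+nC[k+1]≡[n+1]C[k+1])
open import Data.Nat.Divisibility using (_∣_)
open import Data.Nat.DivMod using (m/n*n≡m)
open import Data.Nat.Solver using (module +-*-Solver)
open import Data.Product using (_×_; _,_)
open import Data.Rational as ℚ using (ℚ; 0ℚ; 1ℚ)
import Data.Rational.Properties as ℚ
open import Data.Rational.Unnormalised as ℚᵘ using (mkℚᵘ; *≡*)
import Data.Rational.Unnormalised.Properties as ℚᵘ
open import Level using (0ℓ)
open import Relation.Binary.Bundles using (Setoid)
open import Relation.Binary.PropositionalEquality as ≡ using (_≡_)
open import Relation.Nullary.Decidable using (dec⇒maybe)

-- Factorials and central binomial coefficients.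

nCk*k!*[n∸k]!≡n! : ∀ {n k} → k ℕ.≤ n → (n C k) ℕ.* (k ! ℕ.* (n ℕ.∸ k) !) ≡ n !
nCk*k!*[n∸k]!≡n! {n} {k} k≤n = ≡.trans
  (≡.cong (ℕ._* (k ! ℕ.* (n ℕ.∸ k) !)) (nCk≡n!/k![n-k]! k≤n))
  (m/n*n≡m {{k ℕ.!* (n ℕ.∸ k) !≢0}}
    (≡.subst (_∣ n !) (ℕ.*-comm ((n ℕ.∸ k) !) (k !)) ([n∸k]!k!∣n! k≤n)))

centralBinomial : ℕ → ℕ
centralBinomial n = (n ℕ.+ n) C n

centralBinomial*n!*n!≡[n+n]! : ∀ n → centralBinomial n ℕ.* (n ! ℕ.* n !) ≡ (n ℕ.+ n) !
centralBinomial*n!*n!≡[n+n]! n = ≡.subst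
  (λ m → centralBinomial n ℕ.* (n ! ℕ.* m !) ≡ (n ℕ.+ n) !)
  (ℕ.m+n∸m≡n n n) (nCk*k!*[n∸k]!≡n! (ℕ.m≤m+n n n))

-- After multiplication by `suc n * (n ! * n !)` both sides become the factorial of `2n + 2`, so the
-- ratio of consecutive central binomials is found by cancellation, without division.
centralBinomial-suc : ∀ n →
  suc n ℕ.* centralBinomial (suc n) ≡ 2 ℕ.* suc (2 ℕ.* n) ℕ.* centralBinomial n
centralBinomial-suc n =
  ℕ.*-cancelʳ-≡ _ _ (suc n ℕ.* (n ! ℕ.* n !))
    {{ℕ.m*n≢0 (suc n) (n ! ℕ.* n !) {{_}} {{n ℕ.!* n !≢0}}}} (begin
  suc n ℕ.* c′ ℕ.* (suc n ℕ.* (f ℕ.* f))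
    ≡⟨ solve 3 (λ n c f → (con 1 :+ n) :* c :* ((con 1 :+ n) :* (f :* f))
                 := c :* ((con 1 :+ n) :* f :* ((con 1 :+ n) :* f))) ≡.refl n c′ f ⟩
  c′ ℕ.* (suc n ! ℕ.* suc n !)                           ≡⟨ centralBinomial*n!*n!≡[n+n]! (suc n) ⟩
  (suc n ℕ.+ suc n) !                                    ≡⟨ ≡.cong _! (≡.cong suc (ℕ.+-suc n n)) ⟩
  suc (suc (n ℕ.+ n)) ℕ.* (suc (n ℕ.+ n) ℕ.* (n ℕ.+ n) !)
    ≡⟨ ≡.cong (λ m → suc (suc (n ℕ.+ n)) ℕ.* (suc (n ℕ.+ n) ℕ.* m)) (centralBinomial*n!*n!≡[n+n]! n) ⟨
  suc (suc (n ℕ.+ n)) ℕ.* (suc (n ℕ.+ n) ℕ.* (c ℕ.* (f ℕ.* f)))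
    ≡⟨ solve 3 (λ n c f → (con 2 :+ (n :+ n)) :* ((con 1 :+ (n :+ n)) :* (c :* (f :* f)))
                 := con 2 :* (con 1 :+ con 2 :* n) :* c :* ((con 1 :+ n) :* (f :* f))) ≡.refl n c f ⟩
  2 ℕ.* suc (2 ℕ.* n) ℕ.* c ℕ.* (suc n ℕ.* (f ℕ.* f))    ∎)
  where
  open ≡.≡-Reasoning
  open +-*-Solver
  f  = n !
  c  = centralBinomial n
  c′ = centralBinomial (suc n)

-- Natural numbers and their inverses inside the rationals.

/1-homo-+ : ∀ m n → + (m ℕ.+ n) ℚ./ 1 ≡ (+ m ℚ./ 1) ℚ.+ (+ n ℚ./ 1)
/1-homo-+ m n = ℚ.toℚᵘ-injective (begin
  ℚ.toℚᵘ (+ (m ℕ.+ n) ℚ./ 1)                       ≈⟨ ℚ.toℚᵘ-fromℚᵘ (mkℚᵘ (+ (m ℕ.+ n)) 0) ⟩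
  mkℚᵘ (+ (m ℕ.+ n)) 0
    ≈⟨ *≡* (≡.cong (ℤ._* + 1) (≡.trans (ℤ.pos-+ m n)
         (≡.sym (≡.cong₂ ℤ._+_ (ℤ.*-identityʳ (+ m)) (ℤ.*-identityʳ (+ n)))))) ⟩
  mkℚᵘ (+ m) 0 ℚᵘ.+ mkℚᵘ (+ n) 0                   ≈⟨ ℚᵘ.+-cong (ℚ.toℚᵘ-fromℚᵘ (mkℚᵘ (+ m) 0)) (ℚ.toℚᵘ-fromℚᵘ (mkℚᵘ (+ n) 0)) ⟨
  ℚ.toℚᵘ (+ m ℚ./ 1) ℚᵘ.+ ℚ.toℚᵘ (+ n ℚ./ 1)       ≈⟨ ℚ.toℚᵘ-homo-+ (+ m ℚ./ 1) (+ n ℚ./ 1) ⟨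
  ℚ.toℚᵘ ((+ m ℚ./ 1) ℚ.+ (+ n ℚ./ 1))             ∎)
  where open import Relation.Binary.Reasoning.Setoid ℚᵘ.≃-setoid

/1-homo-* : ∀ m n → + (m ℕ.* n) ℚ./ 1 ≡ (+ m ℚ./ 1) ℚ.* (+ n ℚ./ 1)
/1-homo-* m n = ℚ.toℚᵘ-injective (begin
  ℚ.toℚᵘ (+ (m ℕ.* n) ℚ./ 1)                       ≈⟨ ℚ.toℚᵘ-fromℚᵘ (mkℚᵘ (+ (m ℕ.* n)) 0) ⟩
  mkℚᵘ (+ (m ℕ.* n)) 0                             ≈⟨ *≡* (≡.cong (ℤ._* + 1) (ℤ.pos-* m n)) ⟩
  mkℚᵘ (+ m) 0 ℚᵘ.* mkℚᵘ (+ n) 0                   ≈⟨ ℚᵘ.*-cong (ℚ.toℚᵘ-fromℚᵘ (mkℚᵘ (+ m) 0)) (ℚ.toℚᵘ-fromℚᵘ (mkℚᵘ (+ n) 0)) ⟨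
  ℚ.toℚᵘ (+ m ℚ./ 1) ℚᵘ.* ℚ.toℚᵘ (+ n ℚ./ 1)       ≈⟨ ℚ.toℚᵘ-homo-* (+ m ℚ./ 1) (+ n ℚ./ 1) ⟨
  ℚ.toℚᵘ ((+ m ℚ./ 1) ℚ.* (+ n ℚ./ 1))             ∎)
  where open import Relation.Binary.Reasoning.Setoid ℚᵘ.≃-setoid

1/n*n≡1 : ∀ n → (+ 1 ℚ./ suc n) ℚ.* (+ suc n ℚ./ 1) ≡ 1ℚ
1/n*n≡1 n = ℚ.toℚᵘ-injective (begin
  ℚ.toℚᵘ ((+ 1 ℚ./ suc n) ℚ.* (+ suc n ℚ./ 1))               ≈⟨ ℚ.toℚᵘ-homo-* (+ 1 ℚ./ suc n) (+ suc n ℚ./ 1) ⟩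
  ℚ.toℚᵘ (+ 1 ℚ./ suc n) ℚᵘ.* ℚ.toℚᵘ (+ suc n ℚ./ 1)         ≈⟨ ℚᵘ.*-cong (ℚ.toℚᵘ-fromℚᵘ (mkℚᵘ (+ 1) n)) (ℚ.toℚᵘ-fromℚᵘ (mkℚᵘ (+ suc n) 0)) ⟩
  mkℚᵘ (+ 1) n ℚᵘ.* mkℚᵘ (+ suc n) 0                         ≈⟨ ℚᵘ.*-inverseʳ (mkℚᵘ (+ 1) n) ⟩
  ℚ.toℚᵘ 1ℚ                                                  ∎)
  where open import Relation.Binary.Reasoning.Setoid ℚᵘ.≃-setoid

-- The recurrence in a commutative ring that receives the rationals.

module ℚ-Algebra {a ℓ} (K : CommutativeRing a ℓ)
  (φ : ℚ.+-*-rawRing -Raw-AlmostCommutative⟶ fromCommutativeRing K) where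

  open CommutativeRing K
  open _-Raw-AlmostCommutative⟶_ φ
  open import Algebra.Definitions.RawSemiring (Semiring.rawSemiring semiring) using (_^_)
  open import Algebra.Definitions.RawMonoid +-rawMonoid using (sum)
  open import Relation.Binary.Reasoning.Setoid setoid
  open import Algebra.Solver.Ring ℚ.+-*-rawRing (fromCommutativeRing K) φ
    (λ a b → Maybe.map (λ a≡b → reflexive (≡.cong ⟦_⟧ a≡b)) (dec⇒maybe (a ℚ.≟ b)))
    using (solve; con; _:=_; _:+_; _:*_; _:-_; :-_; _:^_)

  -- In the polynomial ring this is `fromℕ`. Once index arithmetic is moved through it, the ring
  -- solver can treat `ι k` as an indeterminate.
  ι : ℕ → Carrier
  ι n = ⟦ + n ℚ./ 1 ⟧

  ι-homo-+ : ∀ m n → ι (m ℕ.+ n) ≈ ι m + ι n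
  ι-homo-+ m n = trans (reflexive (≡.cong ⟦_⟧ (/1-homo-+ m n))) (+-homo _ _)

  ι-homo-* : ∀ m n → ι (m ℕ.* n) ≈ ι m * ι n
  ι-homo-* m n = trans (reflexive (≡.cong ⟦_⟧ (/1-homo-* m n))) (*-homo _ _)

  Σ<-last : ∀ n (f : ℕ → Carrier) →
    sum {suc n} (λ i → f (toℕ i)) ≈ sum {n} (λ i → f (toℕ i)) + f n
  Σ<-last zero    f = +-comm (f 0) 0#
  Σ<-last (suc n) f = trans (+-congˡ (Σ<-last n (λ i → f (suc i)))) (sym (+-assoc _ _ _))

  -- The truncation below x ^ k of the power series of (1 - x) ^ (- N).
  series : ℕ → ℕ → Carrier → Carrier
  series N k x = sum {k} (λ i → ι ((N ℕ.+ toℕ i ℕ.∸ 1) C toℕ i) * x ^ toℕ i)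

  series-last : ∀ N k x → series N (suc k) x ≈ series N k x + ι ((N ℕ.+ k ℕ.∸ 1) C k) * x ^ k
  series-last N k x = Σ<-last k (λ i → ι ((N ℕ.+ i ℕ.∸ 1) C i) * x ^ i)

  -- The three binomials are the coefficients of `series (suc N)` at `suc k` and at `k`, and of
  -- `series N` at `suc k`; the `∸ 1` keeps the last one in the shape that `series-last` produces.
  ι-pascal : ∀ N k → ι ((N ℕ.+ suc k) C suc k)
                   ≈ ι ((N ℕ.+ k) C k) + ι ((N ℕ.+ suc k ℕ.∸ 1) C suc k)
  ι-pascal N k rewrite ℕ.+-suc N k =
    trans (reflexive (≡.cong ι (≡.sym (nCk+nC[k+1]≡[n+1]C[k+1] (N ℕ.+ k) k))))
          (ι-homo-+ ((N ℕ.+ k) C k) ((N ℕ.+ k) C suc k))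

  -- Truncated form of (1 - x)^(-N-1) = (1 - x)^(-N) + x (1 - x)^(-N-1). The factor `x` raises
  -- degrees by one, hence the shorter truncation in the last term.
  series-pascal : ∀ N k x →
    series (suc N) (suc k) x ≈ series N (suc k) x + x * series (suc N) k x
  series-pascal N zero    x = trans (sym (+-identityʳ _)) (+-congˡ (sym (zeroʳ x)))
  series-pascal N (suc k) x = begin
    series (suc N) (2 ℕ.+ k) x                        ≈⟨ series-last (suc N) (suc k) x ⟩
    series (suc N) (suc k) x + ι ((N ℕ.+ suc k) C suc k) * (x * x ^ k)
      ≈⟨ +-cong (series-pascal N k x) (*-congʳ (ι-pascal N k)) ⟩
    (u + x * v) + (d + b) * (x * x ^ k)
      ≈⟨ solve 6 (λ u v a b x X → (u :+ x :* v) :+ (a :+ b) :* (x :* X)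
                               := (u :+ b :* (x :* X)) :+ x :* (v :+ a :* X)) refl u v d b x (x ^ k) ⟩
    (u + b * (x * x ^ k)) + x * (v + d * x ^ k)
      ≈⟨ +-cong (series-last N (suc k) x) (*-congˡ (series-last (suc N) k x)) ⟨
    series N (2 ℕ.+ k) x + x * series (suc N) (suc k) x ∎
    where
    u = series N (suc k) x
    v = series (suc N) k x
    d = ι ((N ℕ.+ k) C k)
    b = ι ((N ℕ.+ suc k ℕ.∸ 1) C suc k)

  -- If x and y are the probabilities of the two outcomes of a trial, the probability that
  -- the outcome y occurs n times before x does.
  race : Carrier → Carrier → ℕ → Carrier
  race x y n = y ^ n * series n n x

  -- Here and below the unit is written ι 1 wherever the ring solver has to recognise it: its
  -- constants are images of rationals, and ⟦ 1ℚ ⟧ is only provably equal to 1#.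
  race-suc : ∀ {x y} → y ≈ ι 1 - x → ∀ n →
    race x y (suc n) ≈ race x y n + ι ((n ℕ.+ n ℕ.∸ 1) C n) * (x ^ n * y ^ n)
                                - x * (ι (centralBinomial n) * (x ^ n * y ^ n))
  race-suc {x} {y} y≈1-x n = begin
    (y * Y) * T
      ≈⟨ *-congʳ (*-congʳ y≈1-x) ⟩
    ((ι 1 - x) * Y) * T
      ≈⟨ solve 3 (λ x Y T → ((con 1ℚ :- x) :* Y) :* T := Y :* (T :- x :* T)) refl x Y T ⟩
    Y * (T - x * T)
      -- The first `T` is split by the Pascal rule, the second loses only its last term. Both yield
      -- `x * V`, which cancels and leaves `U` and two boundary terms; `suc n + n ∸ 1` computes to
      -- `n + n`, so one of them is central.
      ≈⟨ *-congˡ (+-cong (trans (series-pascal n n x) (+-congʳ (series-last n n x)))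
                         (-‿cong (*-congˡ (series-last (suc n) n x)))) ⟩
    Y * (((U + e * X) + x * V) - x * (V + c * X))
      ≈⟨ solve 7 (λ x X Y U V e c →
           Y :* (((U :+ e :* X) :+ x :* V) :- x :* (V :+ c :* X))
           := Y :* U :+ e :* (X :* Y) :- x :* (c :* (X :* Y))) refl x X Y U V e c ⟩
    Y * U + e * (X * Y) - x * (c * (X * Y)) ∎
    where
    X = x ^ n
    Y = y ^ n
    T = series (suc n) (suc n) x
    U = series n n x
    V = series (suc n) n x
    e = ι ((n ℕ.+ n ℕ.∸ 1) C n)
    c = ι (centralBinomial n)

  -- Consecutive differences and the recurrence.

  module Rosenfeld (x y : Carrier) (y≈1-x : y ≈ ι 1 - x) where

    -- Makes the hypothesis symmetric, so that `race-suc` applies to both races.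
    x≈1-y : x ≈ ι 1 - y
    x≈1-y = begin
      x                 ≈⟨ solve 1 (λ x → x := con 1ℚ :- (con 1ℚ :- x)) refl x ⟩
      ι 1 - (ι 1 - x)   ≈⟨ +-congˡ (-‿cong y≈1-x) ⟨
      ι 1 - y           ∎

    rosenfeld : ℕ → Carrier
    rosenfeld n = 1# - race x y n + race y x n

    Δ : ℕ → Carrier
    Δ n = ι (centralBinomial n) * (x ^ n * y ^ n) * (x - y)

    rosenfeld-suc : ∀ n → rosenfeld (suc n) ≈ rosenfeld n + Δ n
    rosenfeld-suc n = begin
      1# - race x y (suc n) + race y x (suc n)
        ≈⟨ +-cong (+-congˡ (-‿cong (race-suc y≈1-x n)))
                  (trans (race-suc x≈1-y n) (+-cong (+-congˡ (*-congˡ (*-comm _ _)))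
                                                (-‿cong (*-congˡ (*-congˡ (*-comm _ _)))))) ⟩
      1# - (A + e * W - x * (c * W)) + (B + e * W - y * (c * W))
        -- The terms in `e` are symmetric in `x` and `y` and cancel; those in `c` carry the factors
        -- `x` and `y` with opposite signs.
        ≈⟨ solve 8 (λ o x y A B e c W →
             o :- (A :+ e :* W :- x :* (c :* W)) :+ (B :+ e :* W :- y :* (c :* W))
             := o :- A :+ B :+ c :* W :* (x :- y)) refl 1# x y A B e c W ⟩
      rosenfeld n + Δ n ∎
      where
      A = race x y n
      B = race y x n
      W = x ^ n * y ^ n
      e = ι ((n ℕ.+ n ℕ.∸ 1) C n)
      c = ι (centralBinomial n)

    rosenfeld-zero : rosenfeld 0 ≈ 1#
    -- Both races at 0 are `1# * 0#`; with `1#` and `0#` as indeterminates the two equal products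
    -- cancel.
    rosenfeld-zero = solve 2 (λ o z → o :- o :* z :+ o :* z := o) refl 1# 0#

    ι-centralBinomial-suc : ∀ n →
      ι (suc n) * ι (centralBinomial (suc n)) ≈ ι 2 * (ι 1 + ι 2 * ι n) * ι (centralBinomial n)
    ι-centralBinomial-suc n = begin
      ι (suc n) * ι (centralBinomial (suc n))             ≈⟨ ι-homo-* (suc n) (centralBinomial (suc n)) ⟨
      ι (suc n ℕ.* centralBinomial (suc n))               ≡⟨ ≡.cong ι (centralBinomial-suc n) ⟩
      ι (2 ℕ.* suc (2 ℕ.* n) ℕ.* centralBinomial n)       ≈⟨ ι-homo-* (2 ℕ.* suc (2 ℕ.* n)) (centralBinomial n) ⟩
      ι (2 ℕ.* suc (2 ℕ.* n)) * ι (centralBinomial n)     ≈⟨ *-congʳ (ι-homo-* 2 (suc (2 ℕ.* n))) ⟩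
      ι 2 * ι (suc (2 ℕ.* n)) * ι (centralBinomial n)     ≈⟨ *-congʳ (*-congˡ (trans (ι-homo-+ 1 (2 ℕ.* n)) (+-congˡ (ι-homo-* 2 n)))) ⟩
      ι 2 * (ι 1 + ι 2 * ι n) * ι (centralBinomial n)     ∎

    -- The powers contribute one more factor `x * y`, and the central binomials contribute their
    -- ratio, cleared of its denominator `suc n`.
    Δ-suc : ∀ n → ι (suc n) * Δ (suc n) ≈ ι 2 * (ι 1 + ι 2 * ι n) * (x * y) * Δ n
    Δ-suc n = begin
      ι (suc n) * (c′ * ((x * X) * (y * Y)) * (x - y))
        ≈⟨ solve 6 (λ δ c x y X Y → δ :* (c :* ((x :* X) :* (y :* Y)) :* (x :- y))
                   := (δ :* c) :* ((x :* y) :* ((X :* Y) :* (x :- y)))) refl (ι (suc n)) c′ x y X Y ⟩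
      (ι (suc n) * c′) * ((x * y) * ((X * Y) * (x - y)))
        ≈⟨ *-congʳ (ι-centralBinomial-suc n) ⟩
      (ι 2 * (ι 1 + ι 2 * ι n) * c) * ((x * y) * ((X * Y) * (x - y)))
        ≈⟨ solve 6 (λ a c x y X Y → (a :* c) :* ((x :* y) :* ((X :* Y) :* (x :- y)))
                   := a :* (x :* y) :* (c :* (X :* Y) :* (x :- y))) refl (ι 2 * (ι 1 + ι 2 * ι n)) c x y X Y ⟩
      ι 2 * (ι 1 + ι 2 * ι n) * (x * y) * Δ n ∎
      where
      X  = x ^ n
      Y  = y ^ n
      c  = ι (centralBinomial n)
      c′ = ι (centralBinomial (suc n))

    rosenfeld-recurrence : ∀ k → let n = 2 ℕ.+ k ; i = ⟦ + 1 ℚ./ suc k ⟧ in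
      rosenfeld n ≈
        - (i * (ι 4 * ι n * x ^ 2 - ι 4 * x * ι n - ι 6 * x ^ 2 - ι n + ι 6 * x + ι 1)) * rosenfeld (1 ℕ.+ k)
        + i * (ι 2 * x * (x - ι 1) * (ι 2 * ι n - ι 3)) * rosenfeld k
    rosenfeld-recurrence k = begin
      rosenfeld (2 ℕ.+ k)
        ≈⟨ rosenfeld-suc (suc k) ⟩
      P₁ + Δ (suc k)
        -- Both summands are given the factor `i * ι (suc k)`, which equals 1: the second needs
        -- `ι (suc k)` for `Δ-suc`, the first is brought over the common denominator n - 1 = k + 1.
        ≈⟨ solve 2 (λ P D → P :+ D := con 1ℚ :* P :+ con 1ℚ :* D) refl P₁ (Δ (suc k)) ⟩
      ι 1 * P₁ + ι 1 * Δ (suc k)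
        ≈⟨ +-cong (*-congʳ iδ≈1) (*-congʳ iδ≈1) ⟨
      (i * ι (suc k)) * P₁ + (i * ι (suc k)) * Δ (suc k)
        ≈⟨ +-congˡ (trans (*-assoc _ _ _) (*-congˡ (Δ-suc k))) ⟩
      (i * ι (suc k)) * P₁ + i * (ι 2 * (ι 1 + ι 2 * ι k) * (x * y) * Δ k)
        ≈⟨ +-cong (*-congʳ (*-congˡ (ι-homo-+ 1 k))) (*-congˡ (*-cong (*-congˡ (*-congˡ y≈1-x)) Δ≈P₁-P₀)) ⟩
      (i * (ι 1 + ι k)) * P₁ + i * (ι 2 * (ι 1 + ι 2 * ι k) * (x * (ι 1 - x)) * (P₁ - P₀))
        -- With n = k + 2 one has 2k + 1 = 2n - 3 and k + 1 = n - 1, so collecting `P₁` and `P₀`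
        -- gives the stated coefficients.
        ≈⟨ solve 5 (λ i k x P₁ P₀ → let n = con (+ 2 ℚ./ 1) :+ k in
             (i :* (con 1ℚ :+ k)) :* P₁
               :+ i :* (con (+ 2 ℚ./ 1) :* (con 1ℚ :+ con (+ 2 ℚ./ 1) :* k) :* (x :* (con 1ℚ :- x)) :* (P₁ :- P₀))
             := :- (i :* (con (+ 4 ℚ./ 1) :* n :* x :^ 2 :- con (+ 4 ℚ./ 1) :* x :* n :- con (+ 6 ℚ./ 1) :* x :^ 2
                      :- n :+ con (+ 6 ℚ./ 1) :* x :+ con 1ℚ)) :* P₁
               :+ i :* (con (+ 2 ℚ./ 1) :* x :* (x :- con 1ℚ) :* (con (+ 2 ℚ./ 1) :* n :- con (+ 3 ℚ./ 1))) :* P₀)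
             refl i (ι k) x P₁ P₀ ⟩
      recurrence (ι 2 + ι k)
        ≈⟨ recurrence-cong (ι-homo-+ 2 k) ⟨
      recurrence (ι (2 ℕ.+ k)) ∎
      where
      i  = ⟦ + 1 ℚ./ suc k ⟧
      P₁ = rosenfeld (suc k)
      P₀ = rosenfeld k

      iδ≈1 : i * ι (suc k) ≈ ι 1
      iδ≈1 = trans (sym (*-homo _ _)) (reflexive (≡.cong ⟦_⟧ (1/n*n≡1 k)))

      Δ≈P₁-P₀ : Δ k ≈ P₁ - P₀
      Δ≈P₁-P₀ = begin
        Δ k             ≈⟨ solve 2 (λ P D → D := (P :+ D) :- P) refl P₀ (Δ k) ⟩
        (P₀ + Δ k) - P₀ ≈⟨ +-congʳ (rosenfeld-suc k) ⟨
        P₁ - P₀         ∎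

      -- The right side as a function of the ring element n, so that `ι 2 + ι k` can be exchanged
      -- for `ι (2 + k)`.
      recurrence : Carrier → Carrier
      recurrence n = - (i * (ι 4 * n * x ^ 2 - ι 4 * x * n - ι 6 * x ^ 2 - n + ι 6 * x + ι 1)) * P₁
                   + i * (ι 2 * x * (x - ι 1) * (ι 2 * n - ι 3)) * P₀

      recurrence-cong : ∀ {m n} → m ≈ n → recurrence m ≈ recurrence n
      recurrence-cong m≈n = +-cong
        (*-congʳ (-‿cong (*-congˡ (+-congʳ (+-congʳ (+-cong
          (+-congʳ (+-cong (*-congʳ (*-congˡ m≈n)) (-‿cong (*-congˡ m≈n)))) (-‿cong m≈n)))))))
        (*-congʳ (*-congˡ (*-congˡ (+-congʳ (*-congˡ m≈n)))))

-- Polynomials up to equality of coefficients: the additive structure.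

open import Defs
open ≡ using (refl; sym; trans; cong; cong₂)
open import Algebra.Properties.CommutativeSemigroup
  (CommutativeRing.+-commutativeSemigroup ℚ.+-*-commutativeRing)
  using (interchange; x∙yz≈y∙xz)

≈-setoid : Setoid 0ℓ 0ℓ
≈-setoid = record
  { Carrier       = ℚ[q]
  ; _≈_           = _≈_
  ; isEquivalence = record
    { refl  = λ k → refl
    ; sym   = λ p≈r k → sym (p≈r k)
    ; trans = λ p≈r r≈s k → trans (p≈r k) (r≈s k)
    }
  }

open import Relation.Binary.Reasoning.Setoid ≈-setoid

coeff-+ : ∀ p r k → coeff (p + r) k ≡ coeff p k ℚ.+ coeff r k
coeff-+ []      r       k       = sym (ℚ.+-identityˡ _)
coeff-+ (a ∷ p) []      k       = sym (ℚ.+-identityʳ _)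
coeff-+ (a ∷ p) (b ∷ r) zero    = refl
coeff-+ (a ∷ p) (b ∷ r) (suc k) = coeff-+ p r k

coeff-neg : ∀ p k → coeff (- p) k ≡ ℚ.- coeff p k
coeff-neg []      k       = refl
coeff-neg (a ∷ p) zero    = refl
coeff-neg (a ∷ p) (suc k) = coeff-neg p k

infixr 7 _·_

-- With this scaling, `(a ∷ p) * r` computes to `a · r + (0ℚ ∷ p * r)`, and `p / d` is scaling by
-- 1/d.
_·_ : ℚ → ℚ[q] → ℚ[q]
a · p = map (a ℚ.*_) p

coeff-· : ∀ a p k → coeff (a · p) k ≡ a ℚ.* coeff p k
coeff-· a []      k       = sym (ℚ.*-zeroʳ a)
coeff-· a (b ∷ p) zero    = refl
coeff-· a (b ∷ p) (suc k) = coeff-· a p k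

∷-cong : ∀ {a b p r} → a ≡ b → p ≈ r → a ∷ p ≈ b ∷ r
∷-cong a≡b p≈r zero    = a≡b
∷-cong a≡b p≈r (suc k) = p≈r k

0∷0≈0 : 0ℚ ∷ 0# ≈ 0#
0∷0≈0 zero    = refl
0∷0≈0 (suc k) = refl

+-cong : ∀ {p p′ r r′} → p ≈ p′ → r ≈ r′ → p + r ≈ p′ + r′
+-cong {p} {p′} {r} {r′} p≈p′ r≈r′ k =
  trans (coeff-+ p r k) (trans (cong₂ ℚ._+_ (p≈p′ k) (r≈r′ k)) (sym (coeff-+ p′ r′ k)))

+-congˡ : ∀ {p r r′} → r ≈ r′ → p + r ≈ p + r′
+-congˡ {p} {r} {r′} = +-cong {p} {p} {r} {r′} (λ k → refl)

+-congʳ : ∀ {p p′ r} → p ≈ p′ → p + r ≈ p′ + r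
+-congʳ {p} {p′} {r} p≈p′ = +-cong {p} {p′} {r} {r} p≈p′ (λ k → refl)

·-cong : ∀ a {p r} → p ≈ r → a · p ≈ a · r
·-cong a {p} {r} p≈r k = trans (coeff-· a p k) (trans (cong (a ℚ.*_) (p≈r k)) (sym (coeff-· a r k)))

neg-cong : ∀ {p r} → p ≈ r → - p ≈ - r
neg-cong {p} {r} p≈r k = trans (coeff-neg p k) (trans (cong ℚ.-_ (p≈r k)) (sym (coeff-neg r k)))

+-assoc : ∀ p r s → (p + r) + s ≈ p + (r + s)
+-assoc p r s k
  rewrite coeff-+ (p + r) s k | coeff-+ p r k | coeff-+ p (r + s) k | coeff-+ r s k
  = ℚ.+-assoc (coeff p k) (coeff r k) (coeff s k)

+-comm : ∀ p r → p + r ≈ r + p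
+-comm p r k rewrite coeff-+ p r k | coeff-+ r p k = ℚ.+-comm (coeff p k) (coeff r k)

+-identityʳ : ∀ p → p + 0# ≈ p
+-identityʳ p k = trans (coeff-+ p 0# k) (ℚ.+-identityʳ _)

+-inverseˡ : ∀ p → - p + p ≈ 0#
+-inverseˡ p k rewrite coeff-+ (- p) p k | coeff-neg p k = ℚ.+-inverseˡ (coeff p k)

+-inverseʳ : ∀ p → p + - p ≈ 0#
+-inverseʳ p k rewrite coeff-+ p (- p) k | coeff-neg p k = ℚ.+-inverseʳ (coeff p k)

+-interchange : ∀ p r s t → (p + r) + (s + t) ≈ (p + s) + (r + t)
+-interchange p r s t k
  rewrite coeff-+ (p + r) (s + t) k | coeff-+ (p + s) (r + t) k
        | coeff-+ p r k | coeff-+ s t k | coeff-+ p s k | coeff-+ r t k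
  = interchange (coeff p k) (coeff r k) (coeff s k) (coeff t k)

+-x∙yz≈y∙xz : ∀ p r s → p + (r + s) ≈ r + (p + s)
+-x∙yz≈y∙xz p r s k
  rewrite coeff-+ p (r + s) k | coeff-+ r (p + s) k | coeff-+ r s k | coeff-+ p s k
  = x∙yz≈y∙xz (coeff p k) (coeff r k) (coeff s k)

·-distribˡ-+ : ∀ a p r → a · (p + r) ≈ a · p + a · r
·-distribˡ-+ a p r k
  rewrite coeff-· a (p + r) k | coeff-+ (a · p) (a · r) k | coeff-+ p r k | coeff-· a p k | coeff-· a r k
  = ℚ.*-distribˡ-+ a (coeff p k) (coeff r k)

·-assoc : ∀ a b p → (a ℚ.* b) · p ≈ a · b · p
·-assoc a b p k
  rewrite coeff-· (a ℚ.* b) p k | coeff-· a (b · p) k | coeff-· b p k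
  = ℚ.*-assoc a b (coeff p k)

0·p≈0 : ∀ p → 0ℚ · p ≈ 0#
0·p≈0 p k = trans (coeff-· 0ℚ p k) (ℚ.*-zeroˡ (coeff p k))

1·p≈p : ∀ p → 1ℚ · p ≈ p
1·p≈p p k = trans (coeff-· 1ℚ p k) (ℚ.*-identityˡ (coeff p k))

-- Multiplication of polynomials and the ring laws.

*-zeroʳ : ∀ p → p * 0# ≈ 0#
*-zeroʳ []      = λ k → refl
*-zeroʳ (a ∷ p) = begin
  0ℚ ∷ p * 0# ≈⟨ ∷-cong refl (*-zeroʳ p) ⟩
  0ℚ ∷ 0#     ≈⟨ 0∷0≈0 ⟩
  0#          ∎

-- Mirror image of the defining clause of the product, which recurses on the left factor; this is
-- what the induction for commutativity needs.
*-∷ : ∀ p b r → p * (b ∷ r) ≈ b · p + (0ℚ ∷ p * r)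
*-∷ []      b r = λ { zero → refl ; (suc k) → refl }
*-∷ (a ∷ p) b r = ∷-cong (cong (ℚ._+ 0ℚ) (ℚ.*-comm a b)) (begin
  a · r + p * (b ∷ r)           ≈⟨ +-congˡ {a · r} (*-∷ p b r) ⟩
  a · r + (b · p + (0ℚ ∷ p * r)) ≈⟨ +-x∙yz≈y∙xz (a · r) (b · p) (0ℚ ∷ p * r) ⟩
  b · p + (a · r + (0ℚ ∷ p * r)) ∎)

*-comm : ∀ p r → p * r ≈ r * p
*-comm []      r k = sym (*-zeroʳ r k)
*-comm (a ∷ p) r   = begin
  a · r + (0ℚ ∷ p * r) ≈⟨ +-congˡ {a · r} (∷-cong refl (*-comm p r)) ⟩
  a · r + (0ℚ ∷ r * p) ≈⟨ *-∷ r a p ⟨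
  r * (a ∷ p)          ∎

*-congˡ : ∀ p {r r′} → r ≈ r′ → p * r ≈ p * r′
*-congˡ []      r≈r′ = λ k → refl
*-congˡ (a ∷ p) {r} {r′} r≈r′ =
  +-cong {a · r} {a · r′} (·-cong a {r} {r′} r≈r′) (∷-cong refl (*-congˡ p {r} {r′} r≈r′))

-- Equal polynomials may be lists of different lengths, so the recursion on the left factor is
-- avoided by commuting it to the right.
*-congʳ : ∀ r {p p′} → p ≈ p′ → p * r ≈ p′ * r
*-congʳ r {p} {p′} p≈p′ = begin
  p * r  ≈⟨ *-comm p r ⟩
  r * p  ≈⟨ *-congˡ r {p} {p′} p≈p′ ⟩
  r * p′ ≈⟨ *-comm r p′ ⟩
  p′ * r ∎

*-distribˡ-+ : ∀ p r s → p * (r + s) ≈ p * r + p * s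
*-distribˡ-+ []      r s = λ k → refl
*-distribˡ-+ (a ∷ p) r s = begin
  a · (r + s) + (0ℚ ∷ p * (r + s))
    ≈⟨ +-cong {a · (r + s)} {a · r + a · s} (·-distribˡ-+ a r s) (∷-cong refl (*-distribˡ-+ p r s)) ⟩
  (a · r + a · s) + (0ℚ ∷ p * r + p * s)
    ≈⟨ +-interchange (a · r) (a · s) (0ℚ ∷ p * r) (0ℚ ∷ p * s) ⟩
  (a ∷ p) * r + (a ∷ p) * s ∎

*-distribʳ-+ : ∀ p r s → (r + s) * p ≈ r * p + s * p
*-distribʳ-+ p r s = begin
  (r + s) * p   ≈⟨ *-comm (r + s) p ⟩
  p * (r + s)   ≈⟨ *-distribˡ-+ p r s ⟩
  p * r + p * s ≈⟨ +-cong {p * r} {r * p} (*-comm p r) (*-comm p s) ⟩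
  r * p + s * p ∎

·-*-assoc : ∀ a p r → (a · p) * r ≈ a · (p * r)
·-*-assoc a []      r = λ k → refl
·-*-assoc a (b ∷ p) r = begin
  (a ℚ.* b) · r + (0ℚ ∷ (a · p) * r)
    -- The head `0ℚ` of the shifted part is rewritten as `a ℚ.* 0ℚ`, so that `a` can be factored out
    -- of the whole sum.
    ≈⟨ +-cong {(a ℚ.* b) · r} {a · b · r} (·-assoc a b r) (∷-cong (sym (ℚ.*-zeroʳ a)) (·-*-assoc a p r)) ⟩
  a · b · r + a · (0ℚ ∷ p * r) ≈⟨ ·-distribˡ-+ a (b · r) (0ℚ ∷ p * r) ⟨
  a · (b · r + (0ℚ ∷ p * r))   ∎

0∷-*-assoc : ∀ p r → (0ℚ ∷ p) * r ≈ 0ℚ ∷ p * r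
0∷-*-assoc p r = +-congʳ {0ℚ · r} {0#} (0·p≈0 r)

*-assoc : ∀ p r s → (p * r) * s ≈ p * (r * s)
*-assoc []      r s = λ k → refl
*-assoc (a ∷ p) r s = begin
  (a · r + (0ℚ ∷ p * r)) * s         ≈⟨ *-distribʳ-+ s (a · r) (0ℚ ∷ p * r) ⟩
  (a · r) * s + (0ℚ ∷ p * r) * s     ≈⟨ +-cong {(a · r) * s} {a · (r * s)} (·-*-assoc a r s) (0∷-*-assoc (p * r) s) ⟩
  a · (r * s) + (0ℚ ∷ (p * r) * s)   ≈⟨ +-congˡ {a · (r * s)} (∷-cong refl (*-assoc p r s)) ⟩
  a · (r * s) + (0ℚ ∷ p * (r * s))   ∎

-- Connects the division `p / d`, a scaling of coefficients, with the ring product by a constant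
-- used in the general argument.
constant-* : ∀ a p → (a ∷ []) * p ≈ a · p
constant-* a p = begin
  a · p + (0ℚ ∷ 0#) ≈⟨ +-congˡ {a · p} 0∷0≈0 ⟩
  a · p + 0#        ≈⟨ +-identityʳ (a · p) ⟩
  a · p             ∎

*-identityˡ : ∀ p → 1# * p ≈ p
*-identityˡ p = begin
  1# * p ≈⟨ constant-* 1ℚ p ⟩
  1ℚ · p ≈⟨ 1·p≈p p ⟩
  p      ∎

*-identityʳ : ∀ p → p * 1# ≈ p
*-identityʳ p = begin
  p * 1# ≈⟨ *-comm p 1# ⟩
  1# * p ≈⟨ *-identityˡ p ⟩
  p      ∎

ℚ[q]-commutativeRing : CommutativeRing 0ℓ 0ℓ
ℚ[q]-commutativeRing = record
  { Carrier = ℚ[q]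
  ; _≈_     = _≈_
  ; _+_     = _+_
  ; _*_     = _*_
  ; -_      = -_
  ; 0#      = 0#
  ; 1#      = 1#
  ; isCommutativeRing = record
    { isRing = record
      { +-isAbelianGroup = record
        { isGroup = record
          { isMonoid = record
            { isSemigroup = record
              { isMagma = record
                { isEquivalence = Setoid.isEquivalence ≈-setoid
                ; ∙-cong        = λ {p} {p′} {r} {r′} → +-cong {p} {p′} {r} {r′}
                }
              ; assoc = +-assoc
              }
            ; identity = (λ p k → refl) , +-identityʳ
            }
          ; inverse = +-inverseˡ , +-inverseʳ
          ; ⁻¹-cong = λ {p} {r} → neg-cong {p} {r}
          }
        ; comm = +-comm
        }
      ; *-cong = λ {p} {p′} {r} {r′} p≈p′ r≈r′ k →
          trans (*-congʳ r {p} {p′} p≈p′ k) (*-congˡ p′ {r} {r′} r≈r′ k)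
      ; *-assoc    = *-assoc
      ; *-identity = *-identityˡ , *-identityʳ
      ; distrib    = *-distribˡ-+ , *-distribʳ-+
      }
    ; *-comm = *-comm
    }
  }

constants : ℚ.+-*-rawRing -Raw-AlmostCommutative⟶ fromCommutativeRing ℚ[q]-commutativeRing
constants = record
  { ⟦_⟧    = _∷ []
  ; +-homo = λ a b k → refl
  -- The product of two constants computes to the constant `a ℚ.* b ℚ.+ 0ℚ`.
  ; *-homo = λ a b k → cong (λ c → coeff (c ∷ []) k) (sym (ℚ.+-identityʳ (a ℚ.* b)))
  ; -‿homo = λ a k → refl
  ; 0-homo = 0∷0≈0
  ; 1-homo = λ k → refl
  }

-- Specialisation to x = q and y = 1 - q.

open ℚ-Algebra ℚ[q]-commutativeRing constants
open Rosenfeld q (1# - q) (λ k → refl)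

α β : ℕ → ℚ[q]
α n = fromℕ 4 * fromℕ n * q ^ 2 - fromℕ 4 * q * fromℕ n - fromℕ 6 * q ^ 2 - fromℕ n + fromℕ 6 * q + 1#
β n = fromℕ 2 * q * (q - 1#) * (fromℕ 2 * fromℕ n - fromℕ 3)

recurrence : ∀ k → let n = 2 ℕ.+ k in
  R n ≈ - (α n / (n ∸ 1)) * R (n ∸ 1) + (β n / (n ∸ 1)) * R (n ∸ 2)
recurrence k = begin
  R (2 ℕ.+ k)
    -- At these `x` and `y`, `rosenfeld` unfolds to `R`, and `ι 1` computes to `1#`.
    ≈⟨ rosenfeld-recurrence k ⟩
  - (i * a) * R (1 ℕ.+ k) + i * b * R k
    ≈⟨ +-cong { - (i * a) * R (1 ℕ.+ k)} { - (c · a) * R (1 ℕ.+ k)}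
         (*-congʳ (R (1 ℕ.+ k)) { - (i * a)} { - (c · a)} (neg-cong {i * a} {c · a} (constant-* c a)))
         (*-congʳ (R k) {i * b} {c · b} (constant-* c b)) ⟩
  - (c · a) * R (1 ℕ.+ k) + (c · b) * R k ∎
  where
  c = + 1 ℚ./ suc k
  i = c ∷ []
  a = α (2 ℕ.+ k)
  b = β (2 ℕ.+ k)

theorem1 : (R 0 ≈ 1#) × (R 1 ≈ fromℕ 2 * q) ×
    (∀ (n : ℕ) (n≥2 : n ≥ 2) →
    let instance n-1≢0 = n∸1-nonZero n≥2 in
    R n ≈
    - ((fromℕ 4 * fromℕ n * q ^ 2 - fromℕ 4 * q * fromℕ n - fromℕ 6 * q ^ 2
    - fromℕ n + fromℕ 6 * q + 1#) / (n ∸ 1)) * R (n ∸ 1)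
    + ((fromℕ 2 * q * (q - 1#) * (fromℕ 2 * fromℕ n - fromℕ 3)) / (n ∸ 1)) * R (n ∸ 2))
theorem1 =
    rosenfeld-zero
  -- Both sides are closed lists, so each coefficient is settled by computation; from index 3 on
  -- both are zero.
  , (λ { 0 → refl ; 1 → refl ; 2 → refl ; (suc (suc (suc k))) → refl })
  -- Matching the bound down to `z≤n` lets `n∸1-nonZero` compute, and the division becomes the one
  -- by `suc k`.
  , λ { (suc (suc k)) (s≤s (s≤s z≤n)) → recurrence k }
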